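{- Let $\mathcal{K}$ be a nonempty class of nontrivial totally ordered hoops and let $\mathcal{V}=\mathsf{V}(\mathcal{K})$. Let $t(x)$ be a term in one variable in the language $\{\cdot,\to,\top\}$. The following are equivalent: (i) $t(x)$ is a conucleus on $\mathcal{V}$; (ii) $t(x)$ is a conucleus on $$\mathcal{U}:=\mathsf{V}\Big(\Big\{\mathbf{A}_j\in\mathcal{WH}:\bigoplus_{i\in I}\mathbf{A}_i\in\mathcal{K},\ j\in I\Big\}\Big),$$ the variety generated by all Wajsberg components of members of $\mathcal{K}$. The same equivalence holds with "conucleus" replaced by "multiplicative conucleus" in both (i) and (ii).
   Context: A hoop is an algebra $\langle A,\cdot,\to,\top\rangle$ such that $\langle A,\cdot,\top\rangle$ is a commutative monoid and $x\to x=\top$, $x\cdot(x\to y)=y\cdot(y\to x)$, $x\to(y\to z)=(x\cdot y)\to z$; it is partially ordered by $x\le y$ iff $x\to y=\top$, and is a totally ordered hoop if this order is total. A Wajsberg hoop is a hoop satisfying $(x\to y)\to y\approx(y\to x)\to x$; $\mathcal{WH}$ is the variety of Wajsberg hoops. $\mathsf{V}(\cdot)$ denotes the generated variety. Ordinal sum: for a total order $\langle I,\le\rangle$ and hoops $\mathbf{A}_i$ with $A_i\cap A_j=\{\top\}$ for $i\ne j$, $\bigoplus_{i\in I}\mathbf{A}_i$ has universe $\bigcup_i A_i$; on each $A_i$ the operations are those of $\mathbf{A}_i$; if $x\in A_i\setminus\{\top\}$ and $y\in A_j$ with $i<j$, then $x\cdot y=y\cdot x=x$ and $x\to y=\top$;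 if $y\in A_i$, $x\in A_j$, $i<j$, then $x\to y=y$. Known fact: every nontrivial totally ordered hoop $\mathbf{A}$ equals an ordinal sum $\bigoplus_{i\in I}\mathbf{A}_i$ of nontrivial totally ordered Wajsberg hoops; the notation $\bigoplus_{i\in I}\mathbf{A}_i\in\mathcal{K}$ always refers to this decomposition, and the $\mathbf{A}_i$ are its components. A conucleus on a hoop $\mathbf{A}$ is an interior operator $\delta$ ($\delta(a)\le a$, $\delta$ monotone, $\delta\delta=\delta$) with $\delta(a)\cdot\delta(b)\le\delta(a\cdot b)$ and $\delta(a)\cdot\delta(\top)=\delta(a)$. A multiplicative conucleus is an interior operator with $\delta(a\cdot b)=\delta(a)\cdot\delta(b)$. A term $t(x)$ is a (multiplicative) conucleus on a variety if $t^{\mathbf{A}}$ is one on $\mathbf{A}$ for every member $\mathbf{A}$ of the variety. -}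

module Defs where

open import Level using (Level; suc; _⊔_)
open import Algebra.Core using (Op₁; Op₂)
open import Algebra.Bundles using (RawMonoid)
open import Algebra.Definitions using (Congruent₂; IdempotentFun)
open import Algebra.Morphism.Structures using (module MonoidMorphisms)
open import Algebra.Structures using (IsCommutativeMonoid)
open import Data.Product using (Σ; ∃; ∃₂; _×_; _,_; proj₁; proj₂)
open import Function.Definitions using (StrictlySurjective)
open import Relation.Binary.Bundles using (TotalOrder)
open import Relation.Binary.Core using (Rel)
open import Relation.Binary.Definitions using (Monotonic₁; Total; _Respects_)
import Relation.Binary.Construct.NonStrictToStrict as ToStrict
open import Relation.Nullary using (¬_)
open import Relation.Unary using (Pred; _∈_)

-- Algebras are setoid-based, as in the standard library: quotients (hence
-- homomorphic images) change _≈_ instead of the carrier.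

record Hoop (ℓ : Level) : Set (suc ℓ) where
  infixl 7 _∙_
  infixr 6 _⇒_
  infix 4 _≈_ _≤_
  field
    Carrier             : Set ℓ
    _≈_                 : Rel Carrier ℓ
    _∙_                 : Op₂ Carrier
    _⇒_                 : Op₂ Carrier
    ⊤                   : Carrier
    isCommutativeMonoid : IsCommutativeMonoid _≈_ _∙_ ⊤
    ⇒-cong              : Congruent₂ _≈_ _⇒_
    ⇒-refl              : ∀ x → x ⇒ x ≈ ⊤
    divisible           : ∀ x y → x ∙ (x ⇒ y) ≈ y ∙ (y ⇒ x)
    ⇒-curry             : ∀ x y z → x ⇒ (y ⇒ z) ≈ (x ∙ y) ⇒ z

  open IsCommutativeMonoid isCommutativeMonoid public

  rawMonoid : RawMonoid ℓ ℓ
  rawMonoid = record { Carrier = Carrier ; _≈_ = _≈_ ; _∙_ = _∙_ ; ε = ⊤ }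

  _≤_ : Rel Carrier ℓ
  x ≤ y = x ⇒ y ≈ ⊤

private
  variable
    ℓ k : Level

Nontrivial : Pred (Hoop ℓ) ℓ
Nontrivial A = ∃₂ λ x y → ¬ (x ≈ y)
  where open Hoop A

TotallyOrdered : Pred (Hoop ℓ) ℓ
TotallyOrdered A = Total (Hoop._≤_ A)

Wajsberg : Pred (Hoop ℓ) ℓ
Wajsberg A = ∀ x y → (x ⇒ y) ⇒ y ≈ (y ⇒ x) ⇒ x
  where open Hoop A

------------------------------------------------------------------------
-- Subalgebras, products, homomorphisms

record Subuniverse (A : Hoop ℓ) : Set (suc ℓ) where
  open Hoop A
  field
    Member   : Pred Carrier ℓ
    resp     : Member Respects _≈_
    ⊤-closed : Member ⊤
    ∙-closed : ∀ {x y} → Member x → Member y → Member (x ∙ y)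
    ⇒-closed : ∀ {x y} → Member x → Member y → Member (x ⇒ y)

subalgebra : (A : Hoop ℓ) → Subuniverse A → Hoop ℓ
subalgebra A S = record
  { Carrier = Σ Carrier Member
  ; _≈_     = λ x y → proj₁ x ≈ proj₁ y
  ; _∙_     = λ { (x , p) (y , q) → x ∙ y , ∙-closed p q }
  ; _⇒_     = λ { (x , p) (y , q) → x ⇒ y , ⇒-closed p q }
  ; ⊤       = ⊤ , ⊤-closed
  ; isCommutativeMonoid = record
    { isMonoid = record
      { isSemigroup = record
        { isMagma = record
          { isEquivalence = record { refl = refl ; sym = sym ; trans = trans }
          ; ∙-cong        = ∙-cong
          }
        ; assoc = λ x y z → assoc (proj₁ x) (proj₁ y) (proj₁ z)
        }
      ; identity = (λ x → identityˡ (proj₁ x)) , (λ x → identityʳ (proj₁ x))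
      }
    ; comm = λ x y → comm (proj₁ x) (proj₁ y)
    }
  ; ⇒-cong    = ⇒-cong
  ; ⇒-refl    = λ x → ⇒-refl (proj₁ x)
  ; divisible = λ x y → divisible (proj₁ x) (proj₁ y)
  ; ⇒-curry   = λ x y z → ⇒-curry (proj₁ x) (proj₁ y) (proj₁ z)
  }
  where
  open Hoop A
  open Subuniverse S

product : (J : Set ℓ) → (J → Hoop ℓ) → Hoop ℓ
product J A = record
  { Carrier = ∀ j → H.Carrier j
  ; _≈_     = λ x y → ∀ j → H._≈_ j (x j) (y j)
  ; _∙_     = λ x y j → H._∙_ j (x j) (y j)
  ; _⇒_     = λ x y j → H._⇒_ j (x j) (y j)
  ; ⊤       = λ j → H.⊤ j
  ; isCommutativeMonoid = record
    { isMonoid = record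
      { isSemigroup = record
        { isMagma = record
          { isEquivalence = record
            { refl  = λ j → H.refl j
            ; sym   = λ p j → H.sym j (p j)
            ; trans = λ p q j → H.trans j (p j) (q j)
            }
          ; ∙-cong = λ p q j → H.∙-cong j (p j) (q j)
          }
        ; assoc = λ x y z j → H.assoc j (x j) (y j) (z j)
        }
      ; identity = (λ x j → H.identityˡ j (x j)) , (λ x j → H.identityʳ j (x j))
      }
    ; comm = λ x y j → H.comm j (x j) (y j)
    }
  ; ⇒-cong    = λ p q j → H.⇒-cong j (p j) (q j)
  ; ⇒-refl    = λ x j → H.⇒-refl j (x j)
  ; divisible = λ x y j → H.divisible j (x j) (y j)
  ; ⇒-curry   = λ x y z j → H.⇒-curry j (x j) (y j) (z j)
  }
  where module H j = Hoop (A j)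

record IsHoopHomomorphism (A B : Hoop ℓ)
                          (h : Hoop.Carrier A → Hoop.Carrier B) : Set ℓ where
  private
    module A = Hoop A
    module B = Hoop B
  open MonoidMorphisms A.rawMonoid B.rawMonoid using (IsMonoidHomomorphism)
  field
    isMonoidHomomorphism : IsMonoidHomomorphism h
    ⇒-homo               : ∀ x y → h (x A.⇒ y) B.≈ h x B.⇒ h y

-- The generated variety: the least class containing K and closed under
-- homomorphic images, subalgebras and products of set-indexed families.
-- Subalgebras are literal subuniverses; isomorphic copies are obtained as
-- homomorphic images.  Hoops are defined by identities, so closing inside
-- the class of hoops loses no algebra of this signature.

data V (K : Pred (Hoop ℓ) k) : Pred (Hoop ℓ) (suc ℓ ⊔ k) where
  generator : ∀ {A} → A ∈ K → A ∈ V K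
  image     : ∀ {A B} (h : Hoop.Carrier A → Hoop.Carrier B) →
              IsHoopHomomorphism A B h →
              StrictlySurjective (Hoop._≈_ B) h →
              A ∈ V K → B ∈ V K
  sub       : ∀ {A} (S : Subuniverse A) → A ∈ V K → subalgebra A S ∈ V K
  prod      : ∀ (J : Set ℓ) (A : J → Hoop ℓ) →
              (∀ j → A j ∈ V K) → product J A ∈ V K

------------------------------------------------------------------------
-- Ordinal sums of Wajsberg hoops

-- "A is the ordinal sum of the A i, i ∈ I".  Since the universe of the sum
-- is the union of the universes of the summands, and each summand carries
-- the operations of the sum, the summands are given as subuniverses of A.
-- The index order is a setoid, so the family must respect its equality.

record IsOrdinalSum (A : Hoop ℓ) (I : TotalOrder ℓ ℓ ℓ)
                    (S : TotalOrder.Carrier I → Subuniverse A) : Set ℓ where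
  open Hoop A
  private
    module I = TotalOrder I
  open ToStrict I._≈_ I._≤_ using (_<_)

  _∈ₛ_ : Carrier → I.Carrier → Set ℓ
  x ∈ₛ i = Subuniverse.Member (S i) x

  field
    family-resp : ∀ {i j x} → i I.≈ j → x ∈ₛ i → x ∈ₛ j
    union       : ∀ x → ∃ λ i → x ∈ₛ i
    disjoint    : ∀ {i j x} → ¬ (i I.≈ j) → x ∈ₛ i → x ∈ₛ j → x ≈ ⊤
    lower-∙     : ∀ {i j x y} → i < j → x ∈ₛ i → ¬ (x ≈ ⊤) → y ∈ₛ j →
                  x ∙ y ≈ x × y ∙ x ≈ x
    lower-⇒     : ∀ {i j x y} → i < j → x ∈ₛ i → ¬ (x ≈ ⊤) → y ∈ₛ j →
                  x ⇒ y ≈ ⊤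
    upper-⇒     : ∀ {i j x y} → i < j → y ∈ₛ i → x ∈ₛ j → x ⇒ y ≈ y

record WajsbergDecomposition (A : Hoop ℓ) : Set (suc ℓ) where
  field
    I            : TotalOrder ℓ ℓ ℓ
    summand      : TotalOrder.Carrier I → Subuniverse A
    isOrdinalSum : IsOrdinalSum A I summand

  component : TotalOrder.Carrier I → Hoop ℓ
  component i = subalgebra A (summand i)

  field
    nontrivial     : ∀ i → Nontrivial (component i)
    totallyOrdered : ∀ i → TotallyOrdered (component i)
    wajsberg       : ∀ i → Wajsberg (component i)

data WajsbergComponents (K : Pred (Hoop ℓ) k) : Pred (Hoop ℓ) (suc ℓ ⊔ k) where
  component : ∀ {A} → A ∈ K → (D : WajsbergDecomposition A) →
              let open WajsbergDecomposition D renaming (component to Comp) in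
              (j : TotalOrder.Carrier I) → Comp j ∈ WajsbergComponents K

------------------------------------------------------------------------
-- Conuclei and terms

module _ (A : Hoop ℓ) where
  open Hoop A

  -- Compatibility of δ with _≈_ follows from monotonicity.
  record IsInteriorOperator (δ : Op₁ Carrier) : Set ℓ where
    field
      deflationary : ∀ a → δ a ≤ a
      monotone     : Monotonic₁ _≤_ _≤_ δ
      idempotent   : IdempotentFun _≈_ δ

  record IsConucleus (δ : Op₁ Carrier) : Set ℓ where
    field
      isInteriorOperator : IsInteriorOperator δ
      submultiplicative  : ∀ a b → δ a ∙ δ b ≤ δ (a ∙ b)
      unit               : ∀ a → δ a ∙ δ ⊤ ≈ δ a

  record IsMultiplicativeConucleus (δ : Op₁ Carrier) : Set ℓ where
    field
      isInteriorOperator : IsInteriorOperator δ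
      multiplicative     : ∀ a b → δ (a ∙ b) ≈ δ a ∙ δ b

data Term : Set where
  var     : Term
  top     : Term
  _·ₜ_    : Term → Term → Term
  _→ₜ_    : Term → Term → Term

⟦_⟧ : Term → (A : Hoop ℓ) → Op₁ (Hoop.Carrier A)
⟦ var    ⟧ A x = x
⟦ top    ⟧ A x = Hoop.⊤ A
⟦ s ·ₜ t ⟧ A x = Hoop._∙_ A (⟦ s ⟧ A x) (⟦ t ⟧ A x)
⟦ s →ₜ t ⟧ A x = Hoop._⇒_ A (⟦ s ⟧ A x) (⟦ t ⟧ A x)

ConucleusOn : Term → Pred (Hoop ℓ) k → Set (suc ℓ ⊔ k)
ConucleusOn t C = ∀ A → A ∈ C → IsConucleus A (⟦ t ⟧ A)

MultiplicativeConucleusOn : Term → Pred (Hoop ℓ) k → Set (suc ℓ ⊔ k)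
MultiplicativeConucleusOn t C = ∀ A → A ∈ C → IsMultiplicativeConucleus A (⟦ t ⟧ A)

{-# OPTIONS --safe #-}
-- The conucleus conditions are identities: x ≤ y may be replaced by
-- x = y ∙ (y ⇒ z), which turns monotonicity into an identity.  Hence it suffices
-- to compare the generators.  A component is a subalgebra of its ordinal sum.
-- Conversely, t maps each component into itself and, being deflationary, keeps
-- non-units non-units, so for arguments from different components the
-- conditions follow from the definition of the ordinal sum.
--
-- The decomposition of a chain comes from the relation x ≪ y :⇔ y ⇒ x = x, which
-- on non-units is a strict weak order; its incomparability classes, each with ⊤
-- added, are the Wajsberg components.
module Submission where

open import Defs
open import Level using (Level)
open import Algebra.Morphism.Structures using (module MonoidMorphisms)
open import Axiom.ExcludedMiddle using (ExcludedMiddle)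
open import Data.List.Base using (List; []; _∷_)
open import Data.List.Relation.Unary.All as All using (All; []; _∷_)
open import Data.Product using (Σ; _×_; _,_; proj₁; proj₂; swap)
open import Data.Sum using (_⊎_; inj₁; inj₂)
open import Function.Base using (id)
open import Function.Bundles using (_⇔_; mk⇔; module Equivalence)
open import Relation.Binary.Bundles using (Poset; TotalOrder)
open import Relation.Binary.Core using (Rel)
import Relation.Binary.Construct.NonStrictToStrict as ToStrict
import Relation.Binary.Reasoning.PartialOrder as ≤-Reasoning
import Relation.Binary.Reasoning.Setoid as ≈-Reasoning
open import Relation.Nullary using (¬_; yes; no; contradiction)
open import Relation.Nullary.Decidable using (decidable-stable)
open import Relation.Unary using (Pred; Satisfiable; _⊆_; _∩_; _∈_)

private
  variable
    ℓ k k′ : Level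

-- Arithmetic of hoops

module HoopProperties (A : Hoop ℓ) where
  open Hoop A

  ≤-antisym : ∀ {x y} → x ≤ y → y ≤ x → x ≈ y
  ≤-antisym {x} {y} x≤y y≤x = begin
    x             ≈⟨ identityʳ x ⟨
    x ∙ ⊤         ≈⟨ ∙-congˡ x≤y ⟨
    x ∙ (x ⇒ y)   ≈⟨ divisible x y ⟩
    y ∙ (y ⇒ x)   ≈⟨ ∙-congˡ y≤x ⟩
    y ∙ ⊤         ≈⟨ identityʳ y ⟩
    y             ∎
    where open ≈-Reasoning setoid

  ⊤⇒-⇒ : ∀ x y → ⊤ ⇒ (x ⇒ y) ≈ x ⇒ y
  ⊤⇒-⇒ x y = trans (⇒-curry ⊤ x y) (⇒-cong (identityˡ x) refl)

  private
    -- Divisibility turns `⊤ ⇒ x` into `x ∙ (x ⇒ ⊤)`, and currying then leaves an instance of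
    -- `⇒-refl`. This becomes the maximality of `⊤` once `⊤ ⇒ x` is known to equal `x`.
    [⊤⇒x]⇒⊤ : ∀ x → (⊤ ⇒ x) ⇒ ⊤ ≈ ⊤
    [⊤⇒x]⇒⊤ x = begin
      (⊤ ⇒ x) ⇒ ⊤               ≈⟨ ⇒-cong (identityˡ _) refl ⟨
      (⊤ ∙ (⊤ ⇒ x)) ⇒ ⊤         ≈⟨ ⇒-cong (divisible ⊤ x) refl ⟩
      (x ∙ (x ⇒ ⊤)) ⇒ ⊤         ≈⟨ ⇒-cong (comm _ _) refl ⟩
      ((x ⇒ ⊤) ∙ x) ⇒ ⊤         ≈⟨ ⇒-curry _ _ _ ⟨
      (x ⇒ ⊤) ⇒ (x ⇒ ⊤)         ≈⟨ ⇒-refl _ ⟩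
      ⊤                         ∎
      where open ≈-Reasoning setoid

  ⊤⇒-identity : ∀ x → ⊤ ⇒ x ≈ x
  ⊤⇒-identity x = ≤-antisym
    (begin
      (⊤ ⇒ x) ⇒ x               ≈⟨ ⇒-cong (identityˡ _) refl ⟨
      (⊤ ∙ (⊤ ⇒ x)) ⇒ x         ≈⟨ ⇒-cong (divisible ⊤ x) refl ⟩
      (x ∙ (x ⇒ ⊤)) ⇒ x         ≈⟨ ⇒-cong (comm _ _) refl ⟩
      ((x ⇒ ⊤) ∙ x) ⇒ x         ≈⟨ ⇒-curry _ _ _ ⟨
      -- `x ⇒ ⊤` is an implication, so prefixing `⊤ ⇒` does not change it; this gives the shape of
      -- `[⊤⇒x]⇒⊤`.
      (x ⇒ ⊤) ⇒ (x ⇒ x)         ≈⟨ ⇒-cong (sym (⊤⇒-⇒ x ⊤)) (⇒-refl x) ⟩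
      (⊤ ⇒ (x ⇒ ⊤)) ⇒ ⊤         ≈⟨ [⊤⇒x]⇒⊤ (x ⇒ ⊤) ⟩
      ⊤                         ∎)
    (begin
      x ⇒ (⊤ ⇒ x)               ≈⟨ ⇒-curry _ _ _ ⟩
      (x ∙ ⊤) ⇒ x               ≈⟨ ⇒-cong (identityʳ x) refl ⟩
      x ⇒ x                     ≈⟨ ⇒-refl x ⟩
      ⊤                         ∎)
    where open ≈-Reasoning setoid

  ≤-maximum : ∀ x → x ≤ ⊤
  ≤-maximum x = trans (⇒-cong (sym (⊤⇒-identity x)) refl) ([⊤⇒x]⇒⊤ x)

  ⊤≤⇒≈⊤ : ∀ {x} → ⊤ ≤ x → x ≈ ⊤
  ⊤≤⇒≈⊤ {x} = ≤-antisym (≤-maximum x)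

  ≤-reflexive : ∀ {x y} → x ≈ y → x ≤ y
  ≤-reflexive {x} {y} x≈y = trans (⇒-cong x≈y refl) (⇒-refl y)

  -- In a hoop `y ∙ (y ⇒ x)` is the meet of `x` and `y`, and divisibility is its symmetry.
  ≤⇒meet : ∀ {x y} → x ≤ y → y ∙ (y ⇒ x) ≈ x
  ≤⇒meet {x} {y} x≤y = begin
    y ∙ (y ⇒ x)   ≈⟨ divisible y x ⟩
    x ∙ (x ⇒ y)   ≈⟨ ∙-congˡ x≤y ⟩
    x ∙ ⊤         ≈⟨ identityʳ x ⟩
    x             ∎
    where open ≈-Reasoning setoid

  ≤-trans : ∀ {x y z} → x ≤ y → y ≤ z → x ≤ z
  ≤-trans {x} {y} {z} x≤y y≤z = begin
    x ⇒ z                 ≈⟨ ⇒-cong (≤⇒meet x≤y) refl ⟨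
    (y ∙ (y ⇒ x)) ⇒ z     ≈⟨ ⇒-cong (comm _ _) refl ⟩
    ((y ⇒ x) ∙ y) ⇒ z     ≈⟨ ⇒-curry _ _ _ ⟨
    (y ⇒ x) ⇒ (y ⇒ z)     ≈⟨ ⇒-cong refl y≤z ⟩
    (y ⇒ x) ⇒ ⊤           ≈⟨ ≤-maximum _ ⟩
    ⊤                     ∎
    where open ≈-Reasoning setoid

  poset : Poset ℓ ℓ ℓ
  poset = record
    { isPartialOrder = record
      { isPreorder = record
        { isEquivalence = isEquivalence
        ; reflexive     = ≤-reflexive
        ; trans         = ≤-trans
        }
      ; antisym = ≤-antisym
      }
    }

  curry : ∀ {x y z} → x ∙ y ≤ z → x ≤ y ⇒ z
  curry = trans (⇒-curry _ _ _)

  uncurry : ∀ {x y z} → x ≤ y ⇒ z → x ∙ y ≤ z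
  uncurry = trans (sym (⇒-curry _ _ _))

  ⇒-exchange : ∀ x y z → x ⇒ (y ⇒ z) ≈ y ⇒ (x ⇒ z)
  ⇒-exchange x y z = begin
    x ⇒ (y ⇒ z)   ≈⟨ ⇒-curry x y z ⟩
    (x ∙ y) ⇒ z   ≈⟨ ⇒-cong (comm x y) refl ⟩
    (y ∙ x) ⇒ z   ≈⟨ ⇒-curry y x z ⟨
    y ⇒ (x ⇒ z)   ∎
    where open ≈-Reasoning setoid

  x∙y≤y : ∀ x y → x ∙ y ≤ y
  x∙y≤y x y = uncurry (trans (⇒-cong refl (⇒-refl y)) (≤-maximum x))

  x∙y≤x : ∀ x y → x ∙ y ≤ x
  x∙y≤x x y = ≤-trans (≤-reflexive (comm x y)) (x∙y≤y y x)

  x≤y⇒x : ∀ x y → x ≤ y ⇒ x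
  x≤y⇒x x y = curry (x∙y≤x x y)

  ∙-monoʳ-≤ : ∀ x {y z} → y ≤ z → x ∙ y ≤ x ∙ z
  ∙-monoʳ-≤ x {y} {z} y≤z = begin
    x ∙ y   ≈⟨ comm x y ⟩
    y ∙ x   ≤⟨ uncurry (≤-trans y≤z (curry (≤-reflexive (comm z x)))) ⟩
    x ∙ z   ∎
    where open ≤-Reasoning poset

  ⇒-antimonoˡ-≤ : ∀ {x y} z → x ≤ y → y ⇒ z ≤ x ⇒ z
  ⇒-antimonoˡ-≤ z x≤y = curry (≤-trans (∙-monoʳ-≤ _ x≤y) (uncurry (⇒-refl _)))

  x≤[x⇒y]⇒y : ∀ x y → x ≤ (x ⇒ y) ⇒ y
  x≤[x⇒y]⇒y x y = trans (⇒-exchange x (x ⇒ y) y) (⇒-refl _)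

  -- The triple negation law of the antitone Galois connection that `_⇒ y` forms with itself.
  [[x⇒y]⇒y]⇒y : ∀ x y → ((x ⇒ y) ⇒ y) ⇒ y ≈ x ⇒ y
  [[x⇒y]⇒y]⇒y x y =
    ≤-antisym (⇒-antimonoˡ-≤ y (x≤[x⇒y]⇒y x y)) (x≤[x⇒y]⇒y (x ⇒ y) y)

-- Homomorphisms and identities

module Homomorphism {A B : Hoop ℓ} {h : Hoop.Carrier A → Hoop.Carrier B}
                    (isHom : IsHoopHomomorphism A B h) where
  open IsHoopHomomorphism isHom public
  open MonoidMorphisms (Hoop.rawMonoid A) (Hoop.rawMonoid B)
  open IsMonoidHomomorphism isMonoidHomomorphism public
    using (ε-homo) renaming (homo to ∙-homo; ⟦⟧-cong to cong)

proj₁-isHom : (A : Hoop ℓ) (S : Subuniverse A) →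
              IsHoopHomomorphism (subalgebra A S) A proj₁
proj₁-isHom A S = record
  { isMonoidHomomorphism = record
    { isMagmaHomomorphism = record
      { isRelHomomorphism = record { cong = id }
      ; homo              = λ _ _ → Hoop.refl A
      }
    ; ε-homo = Hoop.refl A
    }
  ; ⇒-homo = λ _ _ → Hoop.refl A
  }

projection-isHom : (J : Set ℓ) (A : J → Hoop ℓ) (j : J) →
                   IsHoopHomomorphism (product J A) (A j) (λ x → x j)
projection-isHom J A j = record
  { isMonoidHomomorphism = record
    { isMagmaHomomorphism = record
      { isRelHomomorphism = record { cong = λ x≈y → x≈y j }
      ; homo              = λ _ _ → Hoop.refl (A j)
      }
    ; ε-homo = Hoop.refl (A j)
    }
  ; ⇒-homo = λ _ _ → Hoop.refl (A j)
  }

⟦⟧-cong : (t : Term) (A : Hoop ℓ) → let open Hoop A in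
          ∀ {x y} → x ≈ y → ⟦ t ⟧ A x ≈ ⟦ t ⟧ A y
⟦⟧-cong var      A x≈y = x≈y
⟦⟧-cong top      A x≈y = Hoop.refl A
⟦⟧-cong (s ·ₜ t) A x≈y = Hoop.∙-cong A (⟦⟧-cong s A x≈y) (⟦⟧-cong t A x≈y)
⟦⟧-cong (s →ₜ t) A x≈y = Hoop.⇒-cong A (⟦⟧-cong s A x≈y) (⟦⟧-cong t A x≈y)

⟦⟧-homo : (t : Term) {A B : Hoop ℓ} {h : Hoop.Carrier A → Hoop.Carrier B} →
          IsHoopHomomorphism A B h → let open Hoop B in
          ∀ x → h (⟦ t ⟧ A x) ≈ ⟦ t ⟧ B (h x)
⟦⟧-homo var      {B = B} isHom x = Hoop.refl B
⟦⟧-homo top              isHom x = Homomorphism.ε-homo isHom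
⟦⟧-homo (s ·ₜ t) {B = B} isHom x = Hoop.trans B
  (Homomorphism.∙-homo isHom _ _)
  (Hoop.∙-cong B (⟦⟧-homo s isHom x) (⟦⟧-homo t isHom x))
⟦⟧-homo (s →ₜ t) {B = B} isHom x = Hoop.trans B
  (Homomorphism.⇒-homo isHom _ _)
  (Hoop.⇒-cong B (⟦⟧-homo s isHom x) (⟦⟧-homo t isHom x))

infixl 7 _·_
infixr 6 _⟶_
infix  4 _≐_

-- Two variables suffice for all the laws below. Applying a term is a constructor of its own, so
-- that the laws evaluate definitionally to the conditions on `⟦ t ⟧`.
data Expr : Set where
  x₁ x₂   : Expr
  𝟙       : Expr
  _·_ _⟶_ : Expr → Expr → Expr
  _[_]    : Term → Expr → Expr

data Identity : Set where
  _≐_ : Expr → Expr → Identity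

module _ (A : Hoop ℓ) where
  open Hoop A

  eval : Expr → Carrier → Carrier → Carrier
  eval x₁        a b = a
  eval x₂        a b = b
  eval 𝟙         a b = ⊤
  eval (d · e)   a b = eval d a b ∙ eval e a b
  eval (d ⟶ e)   a b = eval d a b ⇒ eval e a b
  eval (t [ e ]) a b = ⟦ t ⟧ A (eval e a b)

  eval-cong : ∀ e {a b a′ b′} → a ≈ a′ → b ≈ b′ → eval e a b ≈ eval e a′ b′
  eval-cong x₁        p q = p
  eval-cong x₂        p q = q
  eval-cong 𝟙         p q = refl
  eval-cong (d · e)   p q = ∙-cong (eval-cong d p q) (eval-cong e p q)
  eval-cong (d ⟶ e)   p q = ⇒-cong (eval-cong d p q) (eval-cong e p q)
  eval-cong (t [ e ]) p q = ⟦⟧-cong t A (eval-cong e p q)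

  Holds : Identity → Carrier → Carrier → Set ℓ
  Holds (d ≐ e) a b = eval d a b ≈ eval e a b

  Holds-resp : ∀ i {a b a′ b′} → a ≈ a′ → b ≈ b′ → Holds i a b → Holds i a′ b′
  Holds-resp (d ≐ e) p q holds =
    trans (sym (eval-cong d p q)) (trans holds (eval-cong e p q))

  Satisfies : Identity → Set ℓ
  Satisfies i = ∀ a b → Holds i a b

module _ {A B : Hoop ℓ} {h : Hoop.Carrier A → Hoop.Carrier B}
         (isHom : IsHoopHomomorphism A B h) where
  private
    module A = Hoop A
    module B = Hoop B
  open Homomorphism isHom

  eval-homo : ∀ e a b → h (eval A e a b) B.≈ eval B e (h a) (h b)
  eval-homo x₁        a b = B.refl
  eval-homo x₂        a b = B.refl
  eval-homo 𝟙         a b = ε-homo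
  eval-homo (d · e)   a b =
    B.trans (∙-homo _ _) (B.∙-cong (eval-homo d a b) (eval-homo e a b))
  eval-homo (d ⟶ e)   a b =
    B.trans (⇒-homo _ _) (B.⇒-cong (eval-homo d a b) (eval-homo e a b))
  eval-homo (t [ e ]) a b =
    B.trans (⟦⟧-homo t isHom _) (⟦⟧-cong t B (eval-homo e a b))

  Holds-homo : ∀ i {a b} → Holds A i a b → Holds B i (h a) (h b)
  Holds-homo (d ≐ e) {a} {b} holds =
    B.trans (B.sym (eval-homo d a b)) (B.trans (cong holds) (eval-homo e a b))

-- Induction on membership in `V K`. For an image the arguments are pulled back along the
-- surjection. Equality in a subalgebra or a product is equality after the inclusion or after every
-- projection, and these are homomorphisms.
V-Satisfies : {K : Pred (Hoop ℓ) k} → ∀ i → (∀ {A} → A ∈ K → Satisfies A i) →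
              ∀ {A} → A ∈ V K → Satisfies A i
V-Satisfies i K⊨i (generator A∈K) = K⊨i A∈K
V-Satisfies i K⊨i (image {B = B} h isHom surj A∈V) a b
  with surj a | surj b
... | a′ , ha′≈a | b′ , hb′≈b =
  Holds-resp B i ha′≈a hb′≈b (Holds-homo isHom i (V-Satisfies i K⊨i A∈V a′ b′))
V-Satisfies (d ≐ e) K⊨i (sub {A} S A∈V) a b =
  trans (eval-homo isHom d a b)
    (trans (V-Satisfies (d ≐ e) K⊨i A∈V (proj₁ a) (proj₁ b))
           (sym (eval-homo isHom e a b)))
  where
  open Hoop A
  isHom = proj₁-isHom A S
V-Satisfies (d ≐ e) K⊨i (prod J A A∈V) a b j =
  trans (eval-homo isHom d a b)
    (trans (V-Satisfies (d ≐ e) K⊨i (A∈V j) (a j) (b j))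
           (sym (eval-homo isHom e a b)))
  where
  open Hoop (A j)
  isHom = projection-isHom J A j

V-least : {K : Pred (Hoop ℓ) k} {K′ : Pred (Hoop ℓ) k′} → K′ ⊆ V K → V K′ ⊆ V K
V-least K′⊆V (generator A∈K′)         = K′⊆V A∈K′
V-least K′⊆V (image h isHom surj A∈V) = image h isHom surj (V-least K′⊆V A∈V)
V-least K′⊆V (sub S A∈V)              = sub S (V-least K′⊆V A∈V)
V-least K′⊆V (prod J A A∈V)           = prod J A (λ j → V-least K′⊆V (A∈V j))

Equational : Pred (Hoop ℓ) ℓ → Set (Level.suc ℓ)
Equational P = Σ (List Identity) λ is → ∀ A → P A ⇔ All (Satisfies A) is

V-Equational : {P : Pred (Hoop ℓ) ℓ} {K : Pred (Hoop ℓ) k} →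
               Equational P → K ⊆ P → V K ⊆ P
V-Equational (is , P⇔is) K⊆P {A} A∈V = from (P⇔is A) (All.tabulate λ {i} i∈is →
  V-Satisfies i (λ {B} B∈K → All.lookup (to (P⇔is B) (K⊆P B∈K)) i∈is) A∈V)
  where open Equivalence

-- Conuclei are equationally defined

module _ (t : Term) where

  deflationaryLaw monotoneLaw idempotentLaw : Identity
  deflationaryLaw = t [ x₁ ] ⟶ x₁ ≐ 𝟙
  monotoneLaw     = t [ x₁ · (x₁ ⟶ x₂) ] ⟶ t [ x₁ ] ≐ 𝟙
  idempotentLaw   = t [ t [ x₁ ] ] ≐ t [ x₁ ]

  submultiplicativeLaw unitLaw multiplicativeLaw : Identity
  submultiplicativeLaw = t [ x₁ ] · t [ x₂ ] ⟶ t [ x₁ · x₂ ] ≐ 𝟙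
  unitLaw              = t [ x₁ ] · t [ 𝟙 ] ≐ t [ x₁ ]
  multiplicativeLaw    = t [ x₁ · x₂ ] ≐ t [ x₁ ] · t [ x₂ ]

  interior⇒laws : ∀ {A : Hoop ℓ} → IsInteriorOperator A (⟦ t ⟧ A) →
                  Satisfies A deflationaryLaw × Satisfies A monotoneLaw ×
                  Satisfies A idempotentLaw
  interior⇒laws {A = A} int =
      (λ a _ → deflationary a)
    , (λ a b → monotone (HoopProperties.x∙y≤x A a _))
    , (λ a _ → idempotent a)
    where open IsInteriorOperator int

  laws⇒interior : ∀ {A : Hoop ℓ} → Satisfies A deflationaryLaw →
                  Satisfies A monotoneLaw → Satisfies A idempotentLaw →
                  IsInteriorOperator A (⟦ t ⟧ A)
  laws⇒interior {A = A} defl mono idem = record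
    { deflationary = λ a → defl a a
    -- Since `a ≤ b`, `a` is `b ∙ (b ⇒ a)`, so the law is taken at `b` and `a`.
    ; monotone     = λ {a} {b} a≤b →
        trans (⇒-cong (⟦⟧-cong t A (sym (≤⇒meet a≤b))) refl) (mono b a)
    ; idempotent   = λ a → idem a a
    }
    where
    open Hoop A
    open HoopProperties A

  conucleus-equational : Equational {ℓ = ℓ} (λ A → IsConucleus A (⟦ t ⟧ A))
  conucleus-equational =
      deflationaryLaw ∷ monotoneLaw ∷ idempotentLaw
        ∷ submultiplicativeLaw ∷ unitLaw ∷ []
    , λ A → mk⇔
      (λ con → let open IsConucleus con
                   d , m , i = interior⇒laws isInteriorOperator
               in d ∷ m ∷ i ∷ submultiplicative ∷ (λ a _ → unit a) ∷ [])
      (λ { (d ∷ m ∷ i ∷ s ∷ u ∷ []) → record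
           { isInteriorOperator = laws⇒interior d m i
           ; submultiplicative  = s
           ; unit               = λ a → u a a
           } })

  multiplicative-equational :
    Equational {ℓ = ℓ} (λ A → IsMultiplicativeConucleus A (⟦ t ⟧ A))
  multiplicative-equational =
      deflationaryLaw ∷ monotoneLaw ∷ idempotentLaw ∷ multiplicativeLaw ∷ []
    , λ A → mk⇔
      (λ con → let open IsMultiplicativeConucleus con
                   d , m , i = interior⇒laws isInteriorOperator
               in d ∷ m ∷ i ∷ multiplicative ∷ [])
      (λ { (d ∷ m ∷ i ∷ s ∷ []) → record
           { isInteriorOperator = laws⇒interior d m i
           ; multiplicative     = s
           } })

-- The decomposition of a totally ordered hoop

module Chain (em : ExcludedMiddle ℓ) (A : Hoop ℓ) (total : TotallyOrdered A) where
  open Hoop A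
  open HoopProperties A

  infix 4 _≪_ _⊑_ _~_

  -- In an ordinal sum of totally ordered Wajsberg hoops, a non-unit `x` satisfies `x ≪ y` exactly
  -- when `y` is `⊤` or lies in a higher component. But `⊤ ≪ y` holds for every `y`, whence the
  -- non-unit hypotheses below.
  _≪_ _⊑_ _~_ : Rel Carrier ℓ
  x ≪ y = y ⇒ x ≈ x
  x ⊑ y = ¬ (y ≪ x)
  x ~ y = x ⊑ y × y ⊑ x

  ≪-resp : ∀ {x x′ y y′} → x ≈ x′ → y ≈ y′ → x ≪ y → x′ ≪ y′
  ≪-resp x≈x′ y≈y′ x≪y =
    trans (⇒-cong (sym y≈y′) (sym x≈x′)) (trans x≪y x≈x′)

  ~-respˡ : ∀ {x x′ y} → x ≈ x′ → x ~ y → x′ ~ y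
  ~-respˡ x≈x′ (x⊑y , y⊑x) =
      (λ y≪x′ → x⊑y (≪-resp refl (sym x≈x′) y≪x′))
    , (λ x′≪y → y⊑x (≪-resp (sym x≈x′) refl x′≪y))

  -- Otherwise `y ≤ x`, and then `x` equals `y ⇒ x`, which is `⊤`.
  ≪⇒≤ : ∀ {x y} → ¬ (x ≈ ⊤) → x ≪ y → x ≤ y
  ≪⇒≤ {x} {y} x≉⊤ x≪y with total x y
  ... | inj₁ x≤y = x≤y
  ... | inj₂ y≤x = contradiction (trans (sym x≪y) y≤x) x≉⊤

  -- Replacing `x` by `y ⇒ x` turns the product into the meet of `y` and `x`.
  ≪⇒absorb : ∀ {x y} → ¬ (x ≈ ⊤) → x ≪ y → y ∙ x ≈ x
  ≪⇒absorb x≉⊤ x≪y = trans (∙-congˡ (sym x≪y)) (≤⇒meet (≪⇒≤ x≉⊤ x≪y))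

  ≪-≤-trans : ∀ {x y z} → x ≪ y → y ≤ z → x ≪ z
  ≪-≤-trans {x} {y} {z} x≪y y≤z = ≤-antisym
    (≤-trans (⇒-antimonoˡ-≤ x y≤z) (≤-reflexive x≪y)) (x≤y⇒x x z)

  -- The claim is that `d`, that is `z ⇒ x`, lies below `x`. As `z` absorbs `y`, it absorbs
  -- everything below `y`. If `d ≤ y`, then `d` equals `z ∙ d`, which is below `x`. If `y ≤ d`, then
  -- `y` equals `z ∙ y`, which is below `z ∙ d` and so below `x`; hence `x` is `y`.
  ≤-≪-trans : ∀ {x y z} → ¬ (y ≈ ⊤) → x ≤ y → y ≪ z → x ≪ z
  ≤-≪-trans {x} {y} {z} y≉⊤ x≤y y≪z = ≤-antisym d≤x (x≤y⇒x x z)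
    where
    open ≤-Reasoning poset
    d = z ⇒ x
    z∙d≤x : z ∙ d ≤ x
    z∙d≤x = ≤-trans (≤-reflexive (comm z d)) (uncurry (⇒-refl d))
    d≤x : d ≤ x
    d≤x with total d y
    ... | inj₁ d≤y = begin
      d                   ≈⟨ ≤⇒meet d≤y ⟨
      y ∙ (y ⇒ d)         ≈⟨ ∙-congʳ (≪⇒absorb y≉⊤ y≪z) ⟨
      z ∙ y ∙ (y ⇒ d)     ≈⟨ assoc z y (y ⇒ d) ⟩
      z ∙ (y ∙ (y ⇒ d))   ≈⟨ ∙-congˡ (≤⇒meet d≤y) ⟩
      z ∙ d               ≤⟨ z∙d≤x ⟩
      x                   ∎
    ... | inj₂ y≤d = ≤-reflexive (≪-resp (≤-antisym y≤x x≤y) refl y≪z)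
      where
      y≤x : y ≤ x
      y≤x = begin
        y       ≈⟨ ≪⇒absorb y≉⊤ y≪z ⟨
        z ∙ y   ≤⟨ ∙-monoʳ-≤ z y≤d ⟩
        z ∙ d   ≤⟨ z∙d≤x ⟩
        x       ∎

  -- The element m = (y ⇒ x) ⇒ x above y inherits m ≪ z from x ≪ z.
  ≪-cotrans : ∀ {x y z} → x ≪ z → ¬ (x ≪ y) → y ≪ z
  ≪-cotrans {x} {y} {z} x≪z x≪̸y = ≤-≪-trans
    -- If `m` were `⊤`, then `y ⇒ x ≤ x`, that is, `x ≪ y`.
    (λ m≈⊤ → x≪̸y (≤-antisym m≈⊤ (x≤y⇒x x y)))
    (x≤[x⇒y]⇒y y x)
    (trans (⇒-exchange z (y ⇒ x) x) (⇒-cong refl x≪z))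

  ⊑-trans : ∀ {x y z} → x ⊑ y → y ⊑ z → x ⊑ z
  ⊑-trans x⊑y y⊑z z≪x = x⊑y (≪-cotrans z≪x y⊑z)

  ⊑-refl : ∀ {x} → ¬ (x ≈ ⊤) → x ⊑ x
  ⊑-refl {x} x≉⊤ x≪x = x≉⊤ (trans (sym x≪x) (⇒-refl x))

  -- Asymmetry of `≪` on non-units: `x ≪ y` gives `x ≤ y`, and with `y ≪ x` then `y` equals `x ⇒ y`,
  -- which is `⊤`.
  ≪⇒⊑ : ∀ {x y} → ¬ (x ≈ ⊤) → ¬ (y ≈ ⊤) → x ≪ y → x ⊑ y
  ≪⇒⊑ x≉⊤ y≉⊤ x≪y y≪x = y≉⊤ (trans (sym y≪x) (≪⇒≤ x≉⊤ x≪y))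

  ⊑-total : ∀ {x y} → ¬ (x ≈ ⊤) → ¬ (y ≈ ⊤) → x ⊑ y ⊎ y ⊑ x
  ⊑-total {x} {y} x≉⊤ y≉⊤ with em {P = y ≪ x}
  ... | yes y≪x = inj₂ (≪⇒⊑ y≉⊤ x≉⊤ y≪x)
  ... | no  x⊑y = inj₁ x⊑y

  ~-trans : ∀ {x y z} → x ~ y → y ~ z → x ~ z
  ~-trans (x⊑y , y⊑x) (y⊑z , z⊑y) = ⊑-trans x⊑y y⊑z , ⊑-trans z⊑y y⊑x

  -- The non-units themselves serve as indices, with `~` as their equality, so no representatives of
  -- the classes have to be chosen.
  I : TotalOrder ℓ ℓ ℓ
  I = record
    { Carrier = Σ Carrier λ x → ¬ (x ≈ ⊤)
    ; _≈_ = λ i j → proj₁ i ~ proj₁ j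
    ; _≤_ = λ i j → proj₁ i ⊑ proj₁ j
    ; isTotalOrder = record
      { isPartialOrder = record
        { isPreorder = record
          { isEquivalence = record
            { refl  = λ {i} → ⊑-refl (proj₂ i) , ⊑-refl (proj₂ i)
            ; sym   = swap
            ; trans = ~-trans
            }
          ; reflexive = proj₁
          ; trans     = ⊑-trans
          }
        ; antisym = _,_
        }
      ; total = λ i j → ⊑-total (proj₂ i) (proj₂ j)
      }
    }

  private module I = TotalOrder I
  open ToStrict I._≈_ I._≤_ using (_<_)

  -- The condition is put on non-units only, which places `⊤` in every summand.
  InSummand : I.Carrier → Pred Carrier ℓ
  InSummand (i , _) x = ¬ (x ≈ ⊤) → x ~ i

  InSummand-resp : ∀ i {x y} → x ≈ y → InSummand i x → InSummand i y
  InSummand-resp i x≈y x∈i y≉⊤ =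
    ~-respˡ x≈y (x∈i (λ x≈⊤ → y≉⊤ (trans (sym x≈y) x≈⊤)))

  InSummand-⊤ : ∀ i → InSummand i ⊤
  InSummand-⊤ i ⊤≉⊤ = contradiction refl ⊤≉⊤

  InSummand-∙ : ∀ i {x y} → InSummand i x → InSummand i y → InSummand i (x ∙ y)
  InSummand-∙ (i , i≉⊤) {x} {y} x∈i y∈i
    with em {P = x ≈ ⊤} | em {P = y ≈ ⊤}
  ... | yes x≈⊤ | _ = InSummand-resp (i , i≉⊤)
        (sym (trans (∙-congʳ x≈⊤) (identityˡ y))) y∈i
  ... | no _    | yes y≈⊤ = InSummand-resp (i , i≉⊤)
        (sym (trans (∙-congˡ y≈⊤) (identityʳ x))) x∈i
  ... | no x≉⊤  | no y≉⊤ = λ _ → xy⊑i , i⊑xy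
    where
    x~i = x∈i x≉⊤
    y~i = y∈i y≉⊤
    xy⊑i : x ∙ y ⊑ i
    xy⊑i i≪xy = proj₁ x~i (≪-≤-trans i≪xy (x∙y≤x x y))
    -- If x ∙ y ≪ y then x ≤ y ⇒ (x ∙ y) = x ∙ y.
    i⊑xy : i ⊑ x ∙ y
    i⊑xy xy≪i = proj₂ y~i (≪-cotrans xy≪i λ xy≪y → proj₂ x~i
      (≪-resp (≤-antisym (x∙y≤x x y)
                         (≤-trans (curry (⇒-refl _)) (≤-reflexive xy≪y)))
              refl xy≪i))

  -- The class of `x ⇒ y` is that of `y`. If `i ≪ x ⇒ y`, cotransitivity gives `y ≪ x ⇒ y`, so
  -- `x ≤ (x ⇒ y) ⇒ y` yields `x ≤ y` and `x ⇒ y` is `⊤`. If `x ⇒ y ≪ i`, then `y ≪ i` because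
  -- `y ≤ x ⇒ y`.
  InSummand-⇒ : ∀ i {x y} → InSummand i y → InSummand i (x ⇒ y)
  InSummand-⇒ (i , i≉⊤) {x} {y} y∈i x⇒y≉⊤ = x⇒y⊑i , i⊑x⇒y
    where
    y~i : y ~ i
    y~i = y∈i λ y≈⊤ → x⇒y≉⊤ (trans (⇒-cong refl y≈⊤) (≤-maximum x))
    x⇒y⊑i : x ⇒ y ⊑ i
    x⇒y⊑i i≪x⇒y = x⇒y≉⊤ (≤-trans (x≤[x⇒y]⇒y x y)
      (≤-reflexive (≪-cotrans i≪x⇒y (proj₁ y~i))))
    i⊑x⇒y : i ⊑ x ⇒ y
    i⊑x⇒y x⇒y≪i = proj₂ y~i (≤-≪-trans x⇒y≉⊤ (x≤y⇒x y x) x⇒y≪i)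

  summand : I.Carrier → Subuniverse A
  summand i = record
    { Member   = InSummand i
    ; resp     = InSummand-resp i
    ; ⊤-closed = InSummand-⊤ i
    ; ∙-closed = InSummand-∙ i
    ; ⇒-closed = λ _ → InSummand-⇒ i
    }

  -- The source of all three cross-component laws: `lower-∙` follows by absorption, `lower-⇒` by
  -- `≪⇒≤`, and `upper-⇒` is `≪` itself. If it failed, `j ⊑ y ⊑ x ⊑ i` would identify the two
  -- indices.
  <⇒≪ : ∀ i j {x y} → i < j → InSummand i x → ¬ (x ≈ ⊤) → InSummand j y → x ≪ y
  <⇒≪ (i , _) (j , _) {x} {y} (i⊑j , i≁j) x∈i x≉⊤ y∈j with em {P = y ≈ ⊤}
  ... | yes y≈⊤ = trans (⇒-cong y≈⊤ refl) (⊤⇒-identity x)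
  ... | no  y≉⊤ = decidable-stable em λ y⊑x → i≁j
        (i⊑j , ⊑-trans (proj₂ (y∈j y≉⊤)) (⊑-trans y⊑x (proj₁ (x∈i x≉⊤))))

  isOrdinalSum : Nontrivial A → IsOrdinalSum A I summand
  isOrdinalSum (a , b , a≉b) = record
    { family-resp = λ i~j x∈i x≉⊤ → ~-trans (x∈i x≉⊤) i~j
    ; union       = union
    ; disjoint    = λ i≁j x∈i x∈j → decidable-stable em λ x≉⊤ →
                      i≁j (~-trans (swap (x∈i x≉⊤)) (x∈j x≉⊤))
    ; lower-∙     = λ {i} {j} i<j x∈i x≉⊤ y∈j →
                      let yx≈x = ≪⇒absorb x≉⊤ (<⇒≪ i j i<j x∈i x≉⊤ y∈j)
                      in trans (comm _ _) yx≈x , yx≈x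
    ; lower-⇒     = λ {i} {j} i<j x∈i x≉⊤ y∈j → ≪⇒≤ x≉⊤ (<⇒≪ i j i<j x∈i x≉⊤ y∈j)
    ; upper-⇒     = λ {i} {j} → upper-⇒ i j
    }
    where
    -- One of two distinct elements is a non-unit. It provides a summand that contains `⊤`.
    index : I.Carrier
    index with em {P = a ≈ ⊤}
    ... | yes a≈⊤ = b , λ b≈⊤ → a≉b (trans a≈⊤ (sym b≈⊤))
    ... | no  a≉⊤ = a , a≉⊤
    union : ∀ x → Σ I.Carrier λ i → InSummand i x
    union x with em {P = x ≈ ⊤}
    ... | yes x≈⊤ = index , λ x≉⊤ → contradiction x≈⊤ x≉⊤
    ... | no  x≉⊤ = (x , x≉⊤) , λ _ → ⊑-refl x≉⊤ , ⊑-refl x≉⊤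
    upper-⇒ : ∀ i j {x y} → i < j → InSummand i y → InSummand j x → x ⇒ y ≈ y
    upper-⇒ i j {x} {y} i<j y∈i x∈j with em {P = y ≈ ⊤}
    ... | yes y≈⊤ = trans (⇒-cong refl y≈⊤) (trans (≤-maximum x) (sym y≈⊤))
    ... | no  y≉⊤ = <⇒≪ i j i<j y∈i y≉⊤ x∈j

  -- Put m = (x ⇒ y) ⇒ y and w = m ⇒ x.  As w ∙ m = x and m ⇒ y = x ⇒ y, one gets
  -- x ⇒ y ≪ w.  This forces y ≪ w, then x ≪ w because x ~ y, so m ≤ w ⇒ x = x.
  wajsberg-≤ : ∀ i {x y} → InSummand i x → InSummand i y → y ≤ x →
               (x ⇒ y) ⇒ y ≈ (y ⇒ x) ⇒ x
  wajsberg-≤ i {x} {y} x∈i y∈i y≤x = begin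
    m             ≈⟨ ≤-antisym (decidable-stable em ¬¬m≤x) (x≤[x⇒y]⇒y x y) ⟩
    x             ≈⟨ ⊤⇒-identity x ⟨
    ⊤ ⇒ x         ≈⟨ ⇒-cong y≤x refl ⟨
    (y ⇒ x) ⇒ x   ∎
    where
    open ≈-Reasoning setoid
    m = (x ⇒ y) ⇒ y
    w = m ⇒ x
    x⇒y≪w : x ⇒ y ≪ w
    x⇒y≪w = begin
      w ⇒ (x ⇒ y)   ≈⟨ ⇒-cong refl ([[x⇒y]⇒y]⇒y x y) ⟨
      w ⇒ (m ⇒ y)   ≈⟨ ⇒-curry w m y ⟩
      (w ∙ m) ⇒ y   ≈⟨ ⇒-cong (comm w m) refl ⟩
      (m ∙ w) ⇒ y   ≈⟨ ⇒-cong (≤⇒meet (x≤[x⇒y]⇒y x y)) refl ⟩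
      x ⇒ y         ∎
    -- Assuming the contrary supplies the non-units: were `x`, `y` or `x ⇒ y` equal to `⊤`, then
    -- `m ≤ x` would follow.
    ¬¬m≤x : ¬ ¬ (m ≤ x)
    ¬¬m≤x m≰x = m≰x (≤-trans (x≤[x⇒y]⇒y m x) (≤-reflexive x≪w))
      where
      x≉⊤ : ¬ (x ≈ ⊤)
      x≉⊤ x≈⊤ = m≰x (trans (⇒-cong refl x≈⊤) (≤-maximum m))
      y≉⊤ : ¬ (y ≈ ⊤)
      y≉⊤ y≈⊤ = x≉⊤ (⊤≤⇒≈⊤ (trans (⇒-cong (sym y≈⊤) refl) y≤x))
      x⇒y≉⊤ : ¬ (x ⇒ y ≈ ⊤)
      x⇒y≉⊤ x⇒y≈⊤ = m≰x
        (≤-trans (≤-reflexive (trans (⇒-cong x⇒y≈⊤ refl) (⊤⇒-identity y))) y≤x)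
      x~y : x ~ y
      x~y = ~-trans (x∈i x≉⊤) (swap (y∈i y≉⊤))
      x≪w : x ≪ w
      x≪w = ≪-cotrans (≤-≪-trans x⇒y≉⊤ (x≤y⇒x y x) x⇒y≪w) (proj₁ x~y)

  wajsbergDecomposition : Nontrivial A → WajsbergDecomposition A
  wajsbergDecomposition nontriv = record
    { I              = I
    ; summand        = summand
    ; isOrdinalSum   = isOrdinalSum nontriv
    -- An index is a non-unit member of its own class, so it differs from `⊤` there.
    ; nontrivial     = λ { i@(x , x≉⊤) →
        (x , λ _ → ⊑-refl x≉⊤ , ⊑-refl x≉⊤) , (⊤ , InSummand-⊤ i) , x≉⊤ }
    ; totallyOrdered = λ i x y → total (proj₁ x) (proj₁ y)
    ; wajsberg       = wajsberg
    }
    where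
    wajsberg : ∀ i → Wajsberg (subalgebra A (summand i))
    wajsberg i (x , x∈i) (y , y∈i) with total x y
    ... | inj₁ x≤y = sym (wajsberg-≤ i y∈i x∈i x≤y)
    ... | inj₂ y≤x = wajsberg-≤ i x∈i y∈i y≤x

-- Conuclei on ordinal sums

module OrdinalSum (em : ExcludedMiddle ℓ) {A : Hoop ℓ} {I : TotalOrder ℓ ℓ ℓ}
                  {S : TotalOrder.Carrier I → Subuniverse A}
                  (isOrdinalSum : IsOrdinalSum A I S) (t : Term) where
  open Hoop A
  open HoopProperties A
  open IsOrdinalSum isOrdinalSum
  private module I = TotalOrder I
  open ToStrict I._≈_ I._≤_ using (_<_)

  private
    δ : Carrier → Carrier
    δ = ⟦ t ⟧ A

    Comp : I.Carrier → Hoop ℓ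
    Comp i = subalgebra A (S i)

  -- A pair containing `⊤` counts as `same`, because `⊤` lies in every summand. In the other two
  -- cases the lower element can therefore be a non-unit.
  data Position (x y : Carrier) : Set ℓ where
    same  : ∀ {i} → x ∈ₛ i → y ∈ₛ i → Position x y
    below : ∀ {i j} → i < j → x ∈ₛ i → ¬ (x ≈ ⊤) → y ∈ₛ j → Position x y
    above : ∀ {i j} → i < j → y ∈ₛ i → ¬ (y ≈ ⊤) → x ∈ₛ j → Position x y

  position : ∀ x y → Position x y
  position x y with union x | union y
  ... | i , x∈i | j , y∈j
    with em {P = i I.≈ j} | em {P = x ≈ ⊤} | em {P = y ≈ ⊤} | I.total i j
  ... | yes i≈j | _ | _ | _ = same (family-resp i≈j x∈i) y∈j
  ... | no _ | yes x≈⊤ | _ | _ =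
        same (Subuniverse.resp (S j) (sym x≈⊤) (Subuniverse.⊤-closed (S j))) y∈j
  ... | no _ | no _ | yes y≈⊤ | _ =
        same x∈i (Subuniverse.resp (S i) (sym y≈⊤) (Subuniverse.⊤-closed (S i)))
  ... | no i≉j | no x≉⊤ | no _ | inj₁ i≤j = below (i≤j , i≉j) x∈i x≉⊤ y∈j
  ... | no i≉j | no _ | no y≉⊤ | inj₂ j≤i =
        above (j≤i , λ j≈i → i≉j (I.Eq.sym j≈i)) y∈j y≉⊤ x∈i

  δ-component : ∀ {i} (x : Hoop.Carrier (Comp i)) →
                proj₁ (⟦ t ⟧ (Comp i) x) ≈ δ (proj₁ x)
  δ-component {i} = ⟦⟧-homo t (proj₁-isHom A (S i))

  δ-closed : ∀ {i x} → x ∈ₛ i → δ x ∈ₛ i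
  δ-closed {i} {x} x∈i =
    Subuniverse.resp (S i) (δ-component (x , x∈i)) (proj₂ (⟦ t ⟧ (Comp i) (x , x∈i)))

  -- Both variables receive the same element, and a single element lies in some summand.
  lift-unary : ∀ e → (∀ i → Satisfies (Comp i) e) → ∀ x → Holds A e x x
  lift-unary e holds x with union x
  ... | i , x∈i = Holds-homo (proj₁-isHom A (S i)) e (holds i (x , x∈i) (x , x∈i))

  module _ (deflationary : ∀ x → δ x ≤ x) where

    δ-nonunit : ∀ {x} → ¬ (x ≈ ⊤) → ¬ (δ x ≈ ⊤)
    δ-nonunit {x} x≉⊤ δx≈⊤ =
      x≉⊤ (⊤≤⇒≈⊤ (≤-trans (≤-reflexive (sym δx≈⊤)) (deflationary x)))

    -- Both sides collapse to `δ x`, since `x` and `δ x` are non-units of the lower summand and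
    -- absorb the other factor.
    δ-lower-∙ : ∀ {i j x y} → i < j → x ∈ₛ i → ¬ (x ≈ ⊤) → y ∈ₛ j →
                δ (x ∙ y) ≈ δ x ∙ δ y × δ (y ∙ x) ≈ δ y ∙ δ x
    δ-lower-∙ i<j x∈i x≉⊤ y∈j
      with lower-∙ i<j x∈i x≉⊤ y∈j
         | lower-∙ i<j (δ-closed x∈i) (δ-nonunit x≉⊤) (δ-closed y∈j)
    ... | xy≈x , yx≈x | δxδy≈δx , δyδx≈δx =
        trans (⟦⟧-cong t A xy≈x) (sym δxδy≈δx)
      , trans (⟦⟧-cong t A yx≈x) (sym δyδx≈δx)

    -- Across summands `δ` preserves products exactly, so `crossing` may assume this; it yields both
    -- submultiplicativity and multiplicativity.
    lift-binary : ∀ e → (∀ x y → δ (x ∙ y) ≈ δ x ∙ δ y → Holds A e x y) →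
                  (∀ i → Satisfies (Comp i) e) → Satisfies A e
    lift-binary e crossing holds x y with position x y
    ... | same {i} x∈i y∈i =
          Holds-homo (proj₁-isHom A (S i)) e (holds i (x , x∈i) (y , y∈i))
    ... | below i<j x∈i x≉⊤ y∈j = crossing x y (proj₁ (δ-lower-∙ i<j x∈i x≉⊤ y∈j))
    ... | above i<j y∈i y≉⊤ x∈j = crossing x y (proj₂ (δ-lower-∙ i<j y∈i y≉⊤ x∈j))

  interior : (∀ i → IsInteriorOperator (Comp i) (⟦ t ⟧ (Comp i))) →
             IsInteriorOperator A δ
  interior int = record
    { deflationary = deflationary
    ; monotone     = monotone
    ; idempotent   = lift-unary (idempotentLaw t) λ i x _ → Int.idempotent i x
    }
    where
    module Int i = IsInteriorOperator (int i)
    deflationary : ∀ x → δ x ≤ x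
    deflationary = lift-unary (deflationaryLaw t) λ i x _ → Int.deflationary i x
    monotone : ∀ {x y} → x ≤ y → δ x ≤ δ y
    monotone {x} {y} x≤y with position x y
    ... | same {i} x∈i y∈i = trans
          (⇒-cong (sym (δ-component (x , x∈i))) (sym (δ-component (y , y∈i))))
          (Int.monotone i {x , x∈i} {y , y∈i} x≤y)
    ... | below i<j x∈i x≉⊤ y∈j = lower-⇒ i<j
          (δ-closed x∈i) (δ-nonunit deflationary x≉⊤) (δ-closed y∈j)
    -- Here `x ⇒ y` is `y`, so `x ≤ y` would make `y` the unit.
    ... | above i<j y∈i y≉⊤ x∈j =
          contradiction (trans (sym (upper-⇒ i<j y∈i x∈j)) x≤y) y≉⊤

  conucleus : (∀ i → IsConucleus (Comp i) (⟦ t ⟧ (Comp i))) →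
              IsConucleus A δ
  conucleus con = record
    { isInteriorOperator = int
    ; submultiplicative  =
        lift-binary deflationary (submultiplicativeLaw t)
          (λ x y δxy≈δxδy → ≤-reflexive (sym δxy≈δxδy)) Con.submultiplicative
    ; unit = lift-unary (unitLaw t) λ i x _ → Con.unit i x
    }
    where
    module Con i = IsConucleus (con i)
    int = interior Con.isInteriorOperator
    open IsInteriorOperator int using (deflationary)

  multiplicative :
    (∀ i → IsMultiplicativeConucleus (Comp i) (⟦ t ⟧ (Comp i))) →
    IsMultiplicativeConucleus A δ
  multiplicative con = record
    { isInteriorOperator = int
    ; multiplicative     =
        lift-binary deflationary (multiplicativeLaw t) (λ x y → id) Con.multiplicative
    }
    where
    module Con i = IsMultiplicativeConucleus (con i)
    int = interior Con.isInteriorOperator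
    open IsInteriorOperator int using (deflationary)

-- Comparison of the two generated varieties

components⊆V : {K : Pred (Hoop ℓ) k} → WajsbergComponents K ⊆ V K
components⊆V (component A∈K D j) = sub (WajsbergDecomposition.summand D j) (generator A∈K)

-- Stated for any equational `P`, so that it covers both kinds of conuclei. Forwards, the variety of
-- the components is contained in `V K`. Backwards, `P` is lifted from the components to each chain
-- in `K`, and from `K` to `V K` because it is equational.
transfer : ExcludedMiddle ℓ → {P : Pred (Hoop ℓ) ℓ} → Equational P →
           (∀ {A} (D : WajsbergDecomposition A) →
             (∀ i → P (WajsbergDecomposition.component D i)) → P A) →
           (K : Pred (Hoop ℓ) k) → K ⊆ (Nontrivial ∩ TotallyOrdered) →
           (∀ A → A ∈ V K → P A) ⇔ (∀ A → A ∈ V (WajsbergComponents K) → P A)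
transfer em {P} equational lift K K⊆ = mk⇔
  (λ V⊆P A A∈U → V⊆P A (V-least components⊆V A∈U))
  (λ U⊆P A A∈V → V-Equational equational (K⊆P U⊆P) A∈V)
  where
  K⊆P : (∀ A → A ∈ V (WajsbergComponents K) → P A) → K ⊆ P
  K⊆P U⊆P {A} A∈K = lift D λ i → U⊆P _ (generator (component A∈K D i))
    where
    D = Chain.wajsbergDecomposition em A (proj₂ (K⊆ A∈K)) (proj₁ (K⊆ A∈K))

theorem6p2 : {ℓ k : Level} → ExcludedMiddle ℓ →
    (K : Pred (Hoop ℓ) k) → Satisfiable K → K ⊆ (Nontrivial ∩ TotallyOrdered) →
    (t : Term) →
    (ConucleusOn t (V K) ⇔ ConucleusOn t (V (WajsbergComponents K)))
    × (MultiplicativeConucleusOn t (V K) ⇔ MultiplicativeConucleusOn t (V (WajsbergComponents K)))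
theorem6p2 em K _ K⊆ t =
    transfer em (conucleus-equational t)
      (λ D → OrdinalSum.conucleus em (WajsbergDecomposition.isOrdinalSum D) t) K K⊆
  , transfer em (multiplicative-equational t)
      (λ D → OrdinalSum.multiplicative em (WajsbergDecomposition.isOrdinalSum D) t) K K⊆
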